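{- For all integers $k\geq 0$ and all primes $p\geq 3$, $$e_k\left(\frac{p}{1},\ldots,\frac{p}{p-1}\right)+\sum_{j\geq k}(-1)^{j+1}\binom{j}{k}e_j\left(\frac{p}{1},\ldots,\frac{p}{p-1}\right)=0.$$
   Context: $e_j$ denotes the $j$-th elementary symmetric function, here evaluated at the $p-1$ rational numbers $p/i$, $i=1,\ldots,p-1$; $e_0=1$, and $e_j$ of $p-1$ arguments is $0$ for $j\geq p$, so the sum is finite. -}

module Defs where

open import Algebra.Definitions.RawSemiring using (product)
open import Data.Bool.Base using (if_then_else_)
open import Data.Empty using (⊥)
open import Data.Fin.Base using (toℕ)
open import Data.Fin.Subset using (Subset; inside; outside; ∣_∣)
open import Data.Fin.Subset.Properties using (∣p∣≤n)
open import Data.Integer.Base using (+_)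
open import Data.List.Base using (List; []; _∷_; _++_; map; filter; foldr; upTo)
open import Data.List.Membership.Propositional using (_∈_)
open import Data.List.Membership.Propositional.Properties
  using (∈-++⁺ˡ; ∈-++⁺ʳ; ∈-map⁺; ∈-map⁻)
open import Data.List.Properties using (filter-none)
open import Data.List.Relation.Unary.All as All using ()
open import Data.List.Relation.Unary.AllPairs using ([]; _∷_)
open import Data.List.Relation.Unary.Any using (here)
open import Data.List.Relation.Unary.Unique.Propositional using (Unique)
open import Data.List.Relation.Unary.Unique.Propositional.Properties
  using (map⁺; ++⁺)
open import Data.Nat.Base as ℕ using (ℕ; zero; suc; _∸_; _<_)
open import Data.Nat.Properties using (_≟_; _≤?_; <⇒≱)
open import Data.Product.Base using (_,_; ∃-syntax; _×_)
open import Data.Rational.Base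
  using (ℚ; _/_; _+_; 0ℚ; 1ℚ; +-*-rawSemiring)
open import Data.Vec.Base as Vec using (lookup)
open import Data.Vec.Functional using (Vector)
open import Data.Vec.Properties using (∷-injectiveʳ)
open import Relation.Binary.PropositionalEquality
  using (_≡_; refl; cong; subst)

open import Algebra.Definitions.RawSemiring +-*-rawSemiring public
  using (_^_)

sumℚ : List ℚ → ℚ
sumℚ = foldr _+_ 0ℚ

subsets : ∀ n → List (Subset n)
subsets zero    = Vec.[] ∷ []
subsets (suc n) =
  map (outside Vec.∷_) (subsets n) ++ map (inside Vec.∷_) (subsets n)

∏∈ : ∀ {n} → Subset n → Vector ℚ n → ℚ
∏∈ S x = product +-*-rawSemiring (λ i → if lookup S i then x i else 1ℚ)

-- e j x = ∑ { ∏_{i ∈ S} x i | S ⊆ {0,…,n-1}, ∣S∣ = j }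
e : ∀ {n} → ℕ → Vector ℚ n → ℚ
e {n} j x =
  sumℚ (map (λ S → ∏∈ S x) (filter (λ S → ∣ S ∣ ≟ j) (subsets n)))

-- The arguments p/1, …, p/(p-1); Fin counts from 0, hence the shift by one.
p/[1⋯p-1] : ∀ p → Vector ℚ (p ∸ 1)
p/[1⋯p-1] p i = + p / suc (toℕ i)

-- The sum of f j over m ≤ j < n (empty when n ≤ m).
∑[_≤j<_] : ℕ → ℕ → (ℕ → ℚ) → ℚ
∑[ m ≤j< n ] f = sumℚ (map f (filter (m ≤?_) (upTo n)))

-- `subsets n` lists every subset exactly once.
∈-subsets : ∀ {n} (S : Subset n) → S ∈ subsets n
∈-subsets Vec.[]              = here refl
∈-subsets (outside Vec.∷ S)   = ∈-++⁺ˡ (∈-map⁺ _ (∈-subsets S))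
∈-subsets (inside  Vec.∷ S)   = ∈-++⁺ʳ _ (∈-map⁺ _ (∈-subsets S))

subsets-unique : ∀ n → Unique (subsets n)
subsets-unique zero    = All.[] ∷ []
subsets-unique (suc n) =
  ++⁺ (map⁺ ∷-injectiveʳ (subsets-unique n))
      (map⁺ ∷-injectiveʳ (subsets-unique n))
      λ (S∈out , S∈in) → disjoint (∈-map⁻ _ S∈out) (∈-map⁻ _ S∈in)
  where
  disjoint : ∀ {S : Subset (suc n)} →
             ∃[ T ] (T ∈ subsets n × S ≡ outside Vec.∷ T) →
             ∃[ T ] (T ∈ subsets n × S ≡ inside Vec.∷ T) → ⊥
  disjoint (_ , _ , refl) (_ , _ , ())

-- Hence a sum over all j ≥ k of multiples of e j (p/[1⋯p-1] p) may be
-- truncated to k ≤ j < p.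
e-vanishes : ∀ {n j} (x : Vector ℚ n) → n < j → e j x ≡ 0ℚ
e-vanishes {n} {j} x n<j = cong (λ Ss → sumℚ (map (λ S → ∏∈ S x) Ss))
  (filter-none (λ S → ∣ S ∣ ≟ j)
    (All.universal (λ S ∣S∣≡j → <⇒≱ n<j (subst (ℕ._≤ n) ∣S∣≡j (∣p∣≤n S)))
                   (subsets n)))

{-# OPTIONS --safe #-}
-- The proof compares coefficients in the polynomial
-- P(t) = ∏ (1 + t p/i) = ∑ e_j t^j over 1 ≤ i < p.  By the binomial theorem,
-- ∑_j (-1)^j C(j,k) e_j is the coefficient of t^k in
-- P(-1-t) = ∏ ((1 - p/i) - t p/i) = ∏ (-1/i) ((p - i) + t p).  Reversing the
-- order of the factors (p - i) + t p turns this into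
-- ∏ (-1/i) (i + t p) = (-1)^(p-1) P(t), and p - 1 is even.
module Submission where

open import Algebra.Bundles using (CommutativeRing)
import Algebra.Properties.Semiring.Sum as SemiringSum
open import Data.Fin.Base using (toℕ; zero; suc)
open import Data.Fin.Properties using (toℕ-inject₁; toℕ-fromℕ)
open import Data.Fin.Subset using (inside; outside; ∣_∣)
open import Data.Integer.Base as ℤ using (+_)
import Data.Integer.Properties as ℤ
open import Data.List.Base
  using (List; []; _∷_; _++_; map; filter; foldr; upTo; length; applyUpTo; applyDownFrom)
open import Data.List.Properties
  using (map-∘; map-cong; map-applyUpTo; map-upTo; length-upTo; length-applyUpTo;
         reverse-applyUpTo; filter-none; filter-++; filter-≐; map-++)
open import Data.List.Relation.Binary.Permutation.Propositional
  using (_↭_; refl; prep; swap; trans)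
open import Data.List.Relation.Binary.Permutation.Propositional.Properties
  using (↭-reverse)
import Data.List.Relation.Unary.All as All
open import Data.Nat.Base as ℕ using (ℕ; zero; suc; _≥_; _<_; s≤s)
open import Data.Nat.Combinatorics using (_C_; nCk+nC[k+1]≡[n+1]C[k+1]; k>n⇒nCk≡0)
open import Data.Nat.Divisibility using (_∣_; ∣m∣n⇒∣m+n; ∣-refl)
open import Data.Nat.Primality using (Prime; prime⇒irreducible)
open import Data.Nat.Properties using (_≟_; _≤?_; ≤-reflexive; m≤n⇒m≤1+n; ≰⇒>; suc-injective)
open import Data.Product.Base using (_×_; _,_; proj₁; proj₂)
open import Data.Rational.Base
  using (ℚ; _/_; _+_; _*_; -_; _-_; 0ℚ; 1ℚ; fromℚᵘ)
open import Data.Rational.Properties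
  using (+-*-commutativeRing; toℚᵘ-injective; toℚᵘ-fromℚᵘ; toℚᵘ-homo-+; toℚᵘ-homo-*;
         fromℚᵘ-cong; +-identityˡ; +-identityʳ; +-assoc; +-inverseʳ; *-identityˡ;
         *-zeroˡ; *-zeroʳ)
open import Data.Rational.Solver using (module +-*-Solver)
open import Data.Rational.Unnormalised.Base as ℚᵘ using (mkℚᵘ; *≡*)
import Data.Rational.Unnormalised.Properties as ℚᵘ
open import Data.Sum.Base using (_⊎_; inj₁; inj₂)
open import Data.Vec.Base as Vec using ()
open import Data.Vec.Functional using (Vector; tail)
open import Function.Base using (_∘_; const)
open import Relation.Binary.PropositionalEquality
  using (_≡_; refl; sym; cong; cong₂; _≗_; module ≡-Reasoning)
  renaming (trans to ≡-trans)
open import Relation.Nullary using (¬_; yes; no)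
open import Relation.Unary using (Decidable)
open import Defs

open SemiringSum (CommutativeRing.semiring +-*-commutativeRing)
  using (sum; ∑-distrib-+; *-distribˡ-sum; sum-cong-≗; sum-init-last)
open +-*-Solver using (solve; con; _:+_; _:*_; _:=_; :-_; _:-_)
open ≡-Reasoning

-- Natural numbers and fractions as rationals

-- The embedding `toℚᵘ` is injective and additive up to `ℚᵘ.≃`, and `fromℚᵘ` is a right inverse of
-- it up to `ℚᵘ.≃`. So the identity can be checked on unnormalised fractions.
fromℚᵘ-homo-+ : ∀ x y → fromℚᵘ (x ℚᵘ.+ y) ≡ fromℚᵘ x + fromℚᵘ y
fromℚᵘ-homo-+ x y = toℚᵘ-injective
  (ℚᵘ.≃-trans (toℚᵘ-fromℚᵘ (x ℚᵘ.+ y))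
  (ℚᵘ.≃-trans (ℚᵘ.≃-sym (ℚᵘ.+-cong (toℚᵘ-fromℚᵘ x) (toℚᵘ-fromℚᵘ y)))
              (ℚᵘ.≃-sym (toℚᵘ-homo-+ (fromℚᵘ x) (fromℚᵘ y)))))

fromℚᵘ-homo-* : ∀ x y → fromℚᵘ (x ℚᵘ.* y) ≡ fromℚᵘ x * fromℚᵘ y
fromℚᵘ-homo-* x y = toℚᵘ-injective
  (ℚᵘ.≃-trans (toℚᵘ-fromℚᵘ (x ℚᵘ.* y))
  (ℚᵘ.≃-trans (ℚᵘ.≃-sym (ℚᵘ.*-cong (toℚᵘ-fromℚᵘ x) (toℚᵘ-fromℚᵘ y)))
              (ℚᵘ.≃-sym (toℚᵘ-homo-* (fromℚᵘ x) (fromℚᵘ y)))))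

ι : ℕ → ℚ
ι n = + n / 1

-- Normalisation by the gcd does not compute for variable numerators. The fractions are therefore
-- compared by cross-multiplication before they are normalised; the next two lemmas do the same.
ι-+ : ∀ m n → ι (m ℕ.+ n) ≡ ι m + ι n
ι-+ m n = ≡-trans
  (fromℚᵘ-cong {mkℚᵘ (+ (m ℕ.+ n)) 0} {mkℚᵘ (+ m) 0 ℚᵘ.+ mkℚᵘ (+ n) 0}
    (*≡* (cong (ℤ._* + 1) (sym (cong₂ ℤ._+_ (ℤ.*-identityʳ (+ m)) (ℤ.*-identityʳ (+ n)))))))
  (fromℚᵘ-homo-+ (mkℚᵘ (+ m) 0) (mkℚᵘ (+ n) 0))

/-as-* : ∀ m i → + m / suc i ≡ ι m * (+ 1 / suc i)
/-as-* m i = ≡-trans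
  (fromℚᵘ-cong {mkℚᵘ (+ m) i} {mkℚᵘ (+ m) 0 ℚᵘ.* mkℚᵘ (+ 1) i}
    (*≡* (cong₂ ℤ._*_ (sym (ℤ.*-identityʳ (+ m))) (ℤ.*-identityˡ (+ suc i)))))
  (fromℚᵘ-homo-* (mkℚᵘ (+ m) 0) (mkℚᵘ (+ 1) i))

*-inverse-/ : ∀ i → ι (suc i) * (+ 1 / suc i) ≡ 1ℚ
*-inverse-/ i = ≡-trans (sym (/-as-* (suc i) i))
  (fromℚᵘ-cong {mkℚᵘ (+ suc i) i} {mkℚᵘ (+ 1) 0} (*≡* (ℤ.*-comm (+ suc i) (+ 1))))

-- Coefficients of products of linear polynomials

-- coeff [(a₁,b₁), …, (aₙ,bₙ)] k is the coefficient of t^k in ∏ (aᵢ + bᵢ t).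
coeff : List (ℚ × ℚ) → ℕ → ℚ
coeff []            zero    = 1ℚ
coeff []            (suc k) = 0ℚ
coeff ((a , b) ∷ l) zero    = a * coeff l zero
coeff ((a , b) ∷ l) (suc k) = a * coeff l (suc k) + b * coeff l k

coeff-∷-cong : ∀ f {l m} → coeff l ≗ coeff m → coeff (f ∷ l) ≗ coeff (f ∷ m)
coeff-∷-cong (a , b) eq zero    = cong (a *_) (eq zero)
coeff-∷-cong (a , b) eq (suc k) = cong₂ (λ u v → a * u + b * v) (eq (suc k)) (eq k)

-- Two linear factors commute. Each of them may lower the exponent by one, so the exponents 0, 1 and
-- at least 2 unfold differently.
coeff-swap : ∀ f g l → coeff (f ∷ g ∷ l) ≗ coeff (g ∷ f ∷ l)
coeff-swap (a , b) (c , d) l zero =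
  solve 3 (λ a c u → a :* (c :* u) := c :* (a :* u)) refl a c (coeff l zero)
coeff-swap (a , b) (c , d) l (suc zero) =
  solve 6 (λ a b c d u v → a :* (c :* u :+ d :* v) :+ b :* (c :* v)
                        := c :* (a :* u :+ b :* v) :+ d :* (a :* v))
    refl a b c d (coeff l 1) (coeff l 0)
coeff-swap (a , b) (c , d) l (suc (suc k)) =
  solve 7 (λ a b c d u v w → a :* (c :* u :+ d :* v) :+ b :* (c :* v :+ d :* w)
                          := c :* (a :* u :+ b :* v) :+ d :* (a :* v :+ b :* w))
    refl a b c d (coeff l (suc (suc k))) (coeff l (suc k)) (coeff l k)

-- A product is independent of the order of its factors; this is what makes reversing them harmless.
coeff-↭ : ∀ {l m} → l ↭ m → coeff l ≗ coeff m
coeff-↭ refl                k = refl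
coeff-↭ (prep f l↭m)        k = coeff-∷-cong f (coeff-↭ l↭m) k
coeff-↭ (swap {l} f g l↭m)  k = ≡-trans (coeff-swap f g l k)
  (coeff-∷-cong g (coeff-∷-cong f (coeff-↭ l↭m)) k)
coeff-↭ (trans l↭m m↭n)     k = ≡-trans (coeff-↭ l↭m k) (coeff-↭ m↭n k)

infixr 7 _·_
_·_ : ℚ → ℚ × ℚ → ℚ × ℚ
c · (a , b) = c * a , c * b

-- Scalars and linear factors are indexed by the same list, so the scalar product on the right does
-- not depend on `f`. Scalars taken out of one family can thus be put back into another.
coeff-· : ∀ {I : Set} (c : I → ℚ) (f : I → ℚ × ℚ) l k →
          coeff (map (λ i → c i · f i) l) k
            ≡ foldr (λ i → c i *_) 1ℚ l * coeff (map f l) k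
coeff-· c f []      zero    = refl
coeff-· c f []      (suc k) = refl
coeff-· c f (i ∷ l) zero    = ≡-trans
  (cong (c i * proj₁ (f i) *_) (coeff-· c f l zero))
  (solve 4 (λ c a d u → c :* a :* (d :* u) := c :* d :* (a :* u))
    refl (c i) (proj₁ (f i)) _ (coeff (map f l) zero))
coeff-· c f (i ∷ l) (suc k) = ≡-trans
  (cong₂ (λ u v → c i * proj₁ (f i) * u + c i * proj₂ (f i) * v)
    (coeff-· c f l (suc k)) (coeff-· c f l k))
  (solve 6 (λ c a b d u v → c :* a :* (d :* u) :+ c :* b :* (d :* v)
                         := c :* d :* (a :* u :+ b :* v))
    refl (c i) (proj₁ (f i)) (proj₂ (f i)) _ (coeff (map f l) (suc k)) (coeff (map f l) k))

-- The degree of the product is at most the number of its linear factors.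
coeff-vanishes : ∀ l {k} → length l < k → coeff l k ≡ 0ℚ
coeff-vanishes []            {suc k} _         = refl
coeff-vanishes ((a , b) ∷ l) {suc k} (s≤s l<k) = begin
  a * coeff l (suc k) + b * coeff l k
    ≡⟨ cong₂ (λ u v → a * u + b * v)
         (coeff-vanishes l (m≤n⇒m≤1+n l<k)) (coeff-vanishes l l<k) ⟩
  a * 0ℚ + b * 0ℚ
    ≡⟨ cong₂ _+_ (*-zeroʳ a) (*-zeroʳ b) ⟩
  0ℚ ∎

1+_t : List ℚ → List (ℚ × ℚ)
1+_t = map (1ℚ ,_)

-- Elementary symmetric functions as coefficients

sumℚ-++ : ∀ xs ys → sumℚ (xs ++ ys) ≡ sumℚ xs + sumℚ ys
sumℚ-++ []       ys = sym (+-identityˡ (sumℚ ys))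
sumℚ-++ (x ∷ xs) ys =
  ≡-trans (cong (_+_ x) (sumℚ-++ xs ys)) (sym (+-assoc x (sumℚ xs) (sumℚ ys)))

sumℚ-map-* : ∀ {A : Set} c (f : A → ℚ) l →
             sumℚ (map (λ i → c * f i) l) ≡ c * sumℚ (map f l)
sumℚ-map-* c f []      = sym (*-zeroʳ c)
sumℚ-map-* c f (i ∷ l) = ≡-trans (cong (_+_ (c * f i)) (sumℚ-map-* c f l))
  (solve 3 (λ c u v → c :* u :+ c :* v := c :* (u :+ v)) refl c (f i) (sumℚ (map f l)))

filter-map : ∀ {A B : Set} {P : B → Set} (P? : Decidable P) (f : A → B) l →
             filter P? (map f l) ≡ map f (filter (P? ∘ f) l)
filter-map P? f []      = refl
filter-map P? f (i ∷ l) with P? (f i)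
... | yes _ = cong (f i ∷_) (filter-map P? f l)
... | no  _ = filter-map P? f l

module _ {n} (x : Vector ℚ (suc n)) where

  private
    outs = map (outside Vec.∷_) (subsets n)
    ins  = map (inside Vec.∷_) (subsets n)

    part : ℕ → List _ → ℚ
    part j Ss = sumℚ (map (λ S → ∏∈ S x) (filter (λ S → ∣ S ∣ ≟ j) Ss))

    e-split : ∀ j → e j x ≡ part j outs + part j ins
    e-split j = begin
      part j (outs ++ ins)
        ≡⟨ cong (λ Ss → sumℚ (map (λ S → ∏∈ S x) Ss))
             (filter-++ (λ S → ∣ S ∣ ≟ j) outs ins) ⟩
      sumℚ (map (λ S → ∏∈ S x)
        (filter (λ S → ∣ S ∣ ≟ j) outs ++ filter (λ S → ∣ S ∣ ≟ j) ins))
        ≡⟨ cong sumℚ (map-++ (λ S → ∏∈ S x) (filter (λ S → ∣ S ∣ ≟ j) outs) _) ⟩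
      _
        ≡⟨ sumℚ-++ (map (λ S → ∏∈ S x) (filter (λ S → ∣ S ∣ ≟ j) outs)) _ ⟩
      part j outs + part j ins ∎

    part-outs : ∀ j → part j outs ≡ e j (tail x)
    part-outs j = begin
      part j outs
        ≡⟨ cong (λ Ss → sumℚ (map (λ S → ∏∈ S x) Ss))
             (filter-map (λ S → ∣ S ∣ ≟ j) (outside Vec.∷_) (subsets n)) ⟩
      sumℚ (map (λ S → ∏∈ S x)
        (map (outside Vec.∷_) (filter (λ S → ∣ S ∣ ≟ j) (subsets n))))
        ≡⟨ cong sumℚ (sym (map-∘ (filter (λ S → ∣ S ∣ ≟ j) (subsets n)))) ⟩
      -- An omitted first index contributes the factor `1ℚ` by definition of `∏∈`.
      sumℚ (map (λ S → 1ℚ * ∏∈ S (tail x)) (filter (λ S → ∣ S ∣ ≟ j) (subsets n)))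
        ≡⟨ cong sumℚ
             (map-cong (λ S → *-identityˡ (∏∈ S (tail x)))
               (filter (λ S → ∣ S ∣ ≟ j) (subsets n))) ⟩
      e j (tail x) ∎

    part-ins-zero : part 0 ins ≡ 0ℚ
    part-ins-zero = cong (λ Ss → sumℚ (map (λ S → ∏∈ S x) Ss))
      (≡-trans (filter-map (λ S → ∣ S ∣ ≟ 0) (inside Vec.∷_) (subsets n))
        (cong (map _) (filter-none (λ S → ∣ inside Vec.∷ S ∣ ≟ 0)
          (All.universal (λ _ ()) (subsets n)))))

    part-ins-suc : ∀ j → part (suc j) ins ≡ x zero * e j (tail x)
    part-ins-suc j = begin
      part (suc j) ins
        ≡⟨ cong (λ Ss → sumℚ (map (λ S → ∏∈ S x) Ss))
             (filter-map (λ S → ∣ S ∣ ≟ suc j) (inside Vec.∷_) (subsets n)) ⟩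
      sumℚ (map (λ S → ∏∈ S x)
        (map (inside Vec.∷_) (filter (λ S → ∣ inside Vec.∷ S ∣ ≟ suc j) (subsets n))))
        ≡⟨ cong (λ Ss → sumℚ (map (λ S → ∏∈ S x) (map (inside Vec.∷_) Ss)))
             (filter-≐ (λ S → ∣ inside Vec.∷ S ∣ ≟ suc j) (λ S → ∣ S ∣ ≟ j)
               (suc-injective , cong suc) (subsets n)) ⟩
      sumℚ (map (λ S → ∏∈ S x)
        (map (inside Vec.∷_) (filter (λ S → ∣ S ∣ ≟ j) (subsets n))))
        ≡⟨ cong sumℚ (sym (map-∘ (filter (λ S → ∣ S ∣ ≟ j) (subsets n)))) ⟩
      sumℚ (map (λ S → x zero * ∏∈ S (tail x)) (filter (λ S → ∣ S ∣ ≟ j) (subsets n)))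
        ≡⟨ sumℚ-map-* (x zero) (λ S → ∏∈ S (tail x)) (filter (λ S → ∣ S ∣ ≟ j) (subsets n)) ⟩
      x zero * e j (tail x) ∎

  e-zero : e 0 x ≡ e 0 (tail x)
  e-zero = ≡-trans (e-split 0)
    (≡-trans (cong₂ _+_ (part-outs 0) part-ins-zero) (+-identityʳ (e 0 (tail x))))

  -- A subset of size `suc j` either omits the first index, or contains it together with `j` of the
  -- others. This is the recursion of `coeff` for a factor 1 + t `x zero`.
  e-suc : ∀ j → e (suc j) x ≡ e (suc j) (tail x) + x zero * e j (tail x)
  e-suc j = ≡-trans (e-split (suc j)) (cong₂ _+_ (part-outs (suc j)) (part-ins-suc j))

-- Both sides satisfy the same recursion. Taking `X` on all of `ℕ` makes the tail of `X ∘ toℕ` equal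
-- to `X ∘ suc ∘ toℕ` by computation.
e-coeff : ∀ (X : ℕ → ℚ) n → (λ j → e j (X ∘ toℕ {n})) ≗ coeff (1+ applyUpTo X n t)
e-coeff X zero    zero    = refl
e-coeff X zero    (suc j) = refl
e-coeff X (suc n) zero    = begin
  e 0 (X ∘ toℕ {suc n})          ≡⟨ e-zero {n} (X ∘ toℕ) ⟩
  e 0 (X ∘ suc ∘ toℕ {n})        ≡⟨ e-coeff (X ∘ suc) n 0 ⟩
  coeff l 0                      ≡⟨ *-identityˡ (coeff l 0) ⟨
  1ℚ * coeff l 0                 ∎
  where l = 1+ applyUpTo (X ∘ suc) n t
e-coeff X (suc n) (suc j) = begin
  e (suc j) (X ∘ toℕ {suc n})
    ≡⟨ e-suc {n} (X ∘ toℕ) j ⟩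
  e (suc j) (X ∘ suc ∘ toℕ {n}) + X 0 * e j (X ∘ suc ∘ toℕ {n})
    ≡⟨ cong₂ (λ u v → u + X 0 * v) (e-coeff (X ∘ suc) n (suc j)) (e-coeff (X ∘ suc) n j) ⟩
  coeff l (suc j) + X 0 * coeff l j
    ≡⟨ cong (_+ X 0 * coeff l j) (*-identityˡ (coeff l (suc j))) ⟨
  1ℚ * coeff l (suc j) + X 0 * coeff l j ∎
  where l = 1+ applyUpTo (X ∘ suc) n t

-- The substitution t ↦ -1 - t

-- The linear functional sending t^j to `g j`, applied to ∏ (1 + x t) over `xs`. The degree is at
-- most `length xs`, hence `suc (length xs)` terms.
weighted : (ℕ → ℚ) → List ℚ → ℚ
weighted g xs = sum {suc (length xs)} (λ i → g (toℕ i) * coeff (1+ xs t) (toℕ i))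

sum-toℕ-last : ∀ (f : ℕ → ℚ) n → sum {suc n} (f ∘ toℕ) ≡ sum {n} (f ∘ toℕ) + f n
sum-toℕ-last f n = ≡-trans (sum-init-last {n} (f ∘ toℕ))
  (cong₂ _+_ (sum-cong-≗ {n} (cong f ∘ toℕ-inject₁)) (cong f (toℕ-fromℕ n)))

length-1+_t : ∀ xs → length (1+ xs t) ≡ length xs
length-1+ []     t = refl
length-1+ x ∷ xs t = cong suc length-1+ xs t

-- In the product with 1 + x t, the term x t raises each exponent by one, which shifts the weights
-- to `g ∘ suc`.
weighted-∷ : ∀ g x xs → weighted g (x ∷ xs) ≡ weighted g xs + x * weighted (g ∘ suc) xs
weighted-∷ g x xs = begin
  g 0 * (1ℚ * c 0) + sum {m} (λ i → g (suc (toℕ i)) * (1ℚ * c (suc (toℕ i)) + x * c (toℕ i)))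
    ≡⟨ cong₂ _+_ (cong (g 0 *_) (*-identityˡ (c 0)))
         (sum-cong-≗ {m} λ i →
           solve 4 (λ x g u v → g :* (con 1ℚ :* u :+ x :* v) := g :* u :+ x :* (g :* v))
             refl x (g (suc (toℕ i))) (c (suc (toℕ i))) (c (toℕ i))) ⟩
  g 0 * c 0 + sum {m} (λ i → h (suc (toℕ i)) + x * (g (suc (toℕ i)) * c (toℕ i)))
    ≡⟨ cong (_+_ (g 0 * c 0))
         (∑-distrib-+ {m} (λ i → h (suc (toℕ i)))
           (λ i → x * (g (suc (toℕ i)) * c (toℕ i)))) ⟩
  g 0 * c 0 + (sum {m} (λ i → h (suc (toℕ i)))
               + sum {m} (λ i → x * (g (suc (toℕ i)) * c (toℕ i))))
    ≡⟨ +-assoc (g 0 * c 0) _ _ ⟨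
  sum {suc m} (h ∘ toℕ) + sum {m} (λ i → x * (g (suc (toℕ i)) * c (toℕ i)))
    -- The first sum runs one exponent beyond the degree bound for `xs`, so its last term is zero.
    ≡⟨ cong₂ _+_ last-vanishes
         (sym (*-distribˡ-sum {m} x (λ i → g (suc (toℕ i)) * c (toℕ i)))) ⟩
  weighted g xs + x * weighted (g ∘ suc) xs ∎
  where
  m = suc (length xs)
  c = coeff (1+ xs t)
  h = λ j → g j * c j
  c[m]≡0 : c m ≡ 0ℚ
  c[m]≡0 = coeff-vanishes (1+ xs t) (≤-reflexive (cong suc length-1+ xs t))
  last-vanishes : sum {suc m} (h ∘ toℕ) ≡ weighted g xs
  last-vanishes = begin
    sum {suc m} (h ∘ toℕ)         ≡⟨ sum-toℕ-last h m ⟩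
    weighted g xs + g m * c m     ≡⟨ cong (λ u → weighted g xs + g m * u) c[m]≡0 ⟩
    weighted g xs + g m * 0ℚ      ≡⟨ cong (_+_ (weighted g xs)) (*-zeroʳ (g m)) ⟩
    weighted g xs + 0ℚ            ≡⟨ +-identityʳ (weighted g xs) ⟩
    weighted g xs                 ∎

weighted-cong : ∀ {g h} → g ≗ h → ∀ xs → weighted g xs ≡ weighted h xs
weighted-cong g≗h xs = sum-cong-≗ {suc (length xs)}
  (λ i → cong (_* coeff (1+ xs t) (toℕ i)) (g≗h (toℕ i)))

weighted-+ : ∀ g h xs → weighted (λ j → g j + h j) xs ≡ weighted g xs + weighted h xs
weighted-+ g h xs = ≡-trans
  (sum-cong-≗ {m} λ i → solve 3 (λ g h c → (g :+ h) :* c := g :* c :+ h :* c)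
    refl (g (toℕ i)) (h (toℕ i)) (coeff (1+ xs t) (toℕ i)))
  (∑-distrib-+ {m} (λ i → g (toℕ i) * coeff (1+ xs t) (toℕ i))
                   (λ i → h (toℕ i) * coeff (1+ xs t) (toℕ i)))
  where m = suc (length xs)

weighted-* : ∀ a g xs → weighted (λ j → a * g j) xs ≡ a * weighted g xs
weighted-* a g xs = ≡-trans
  (sum-cong-≗ {m} λ i → solve 3 (λ a g c → a :* g :* c := a :* (g :* c))
    refl a (g (toℕ i)) (coeff (1+ xs t) (toℕ i)))
  (sym (*-distribˡ-sum {m} a (λ i → g (toℕ i) * coeff (1+ xs t) (toℕ i))))
  where m = suc (length xs)

-- Minus the coefficient of t^k in (-1 - t)^j.
±C : ℕ → ℕ → ℚ
±C k j = (- 1ℚ) ^ suc j * ι (j C k)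

±C-zero : ∀ j → ±C 0 (suc j) ≡ - 1ℚ * ±C 0 j
±C-zero j = solve 1 (λ s → (:- con 1ℚ) :* s :* con 1ℚ := (:- con 1ℚ) :* (s :* con 1ℚ))
  refl ((- 1ℚ) ^ suc j)

-- Pascal's rule, in the form of multiplication by -1 - t.
±C-suc : ∀ k j → ±C (suc k) (suc j) ≡ - 1ℚ * (±C k j + ±C (suc k) j)
±C-suc k j = begin
  - 1ℚ * s * ι (suc j C suc k)
    ≡⟨ cong (λ n → - 1ℚ * s * ι n) (nCk+nC[k+1]≡[n+1]C[k+1] j k) ⟨
  - 1ℚ * s * ι (j C k ℕ.+ j C suc k)
    ≡⟨ cong (- 1ℚ * s *_) (ι-+ (j C k) (j C suc k)) ⟩
  - 1ℚ * s * (ι (j C k) + ι (j C suc k))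
    ≡⟨ solve 3 (λ s u v → (:- con 1ℚ) :* s :* (u :+ v)
                       := (:- con 1ℚ) :* (s :* u :+ s :* v)) refl s _ _ ⟩
  - 1ℚ * (s * ι (j C k) + s * ι (j C suc k)) ∎
  where s = (- 1ℚ) ^ suc j

-- Induction on the factors: under t ↦ -1 - t, the factor 1 + x t becomes (1 - x) - x t. The overall
-- minus sign is the one built into `±C`.
weighted-±C : ∀ xs k → weighted (±C k) xs ≡ - coeff (map (λ x → 1ℚ - x , - x) xs) k
weighted-±C []       zero    = refl
weighted-±C []       (suc k) = refl
weighted-±C (x ∷ xs) zero    = begin
  weighted (±C 0) (x ∷ xs)
    ≡⟨ weighted-∷ (±C 0) x xs ⟩
  weighted (±C 0) xs + x * weighted (±C 0 ∘ suc) xs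
    ≡⟨ cong (λ w → weighted (±C 0) xs + x * w)
         (≡-trans (weighted-cong ±C-zero xs) (weighted-* (- 1ℚ) (±C 0) xs)) ⟩
  weighted (±C 0) xs + x * (- 1ℚ * weighted (±C 0) xs)
    ≡⟨ cong (λ w → w + x * (- 1ℚ * w)) (weighted-±C xs 0) ⟩
  - u + x * (- 1ℚ * - u)
    ≡⟨ solve 2 (λ x u → (:- u) :+ x :* ((:- con 1ℚ) :* (:- u))
                     := :- ((con 1ℚ :- x) :* u)) refl x u ⟩
  - ((1ℚ - x) * u) ∎
  where u = coeff (map (λ x → 1ℚ - x , - x) xs) 0
weighted-±C (x ∷ xs) (suc k) = begin
  weighted (±C (suc k)) (x ∷ xs)
    ≡⟨ weighted-∷ (±C (suc k)) x xs ⟩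
  weighted (±C (suc k)) xs + x * weighted (±C (suc k) ∘ suc) xs
    ≡⟨ cong (λ w → weighted (±C (suc k)) xs + x * w)
         (≡-trans (weighted-cong (±C-suc k) xs)
         (≡-trans (weighted-* (- 1ℚ) (λ j → ±C k j + ±C (suc k) j) xs)
                  (cong (- 1ℚ *_) (weighted-+ (±C k) (±C (suc k)) xs)))) ⟩
  weighted (±C (suc k)) xs + x * (- 1ℚ * (weighted (±C k) xs + weighted (±C (suc k)) xs))
    ≡⟨ cong₂ (λ v w → w + x * (- 1ℚ * (v + w))) (weighted-±C xs k) (weighted-±C xs (suc k)) ⟩
  - v + x * (- 1ℚ * (- u + - v))
    ≡⟨ solve 3 (λ x u v → (:- v) :+ x :* ((:- con 1ℚ) :* ((:- u) :+ (:- v)))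
                       := :- ((con 1ℚ :- x) :* v :+ (:- x) :* u)) refl x u v ⟩
  - ((1ℚ - x) * v + - x * u) ∎
  where
  u = coeff (map (λ x → 1ℚ - x , - x) xs) k
  v = coeff (map (λ x → 1ℚ - x , - x) xs) (suc k)

-- The truncated sum

sumℚ-map-filter : ∀ {A : Set} {P : A → Set} (P? : Decidable P) (f : A → ℚ) →
                  (∀ i → ¬ P i → f i ≡ 0ℚ) →
                  ∀ l → sumℚ (map f (filter P? l)) ≡ sumℚ (map f l)
sumℚ-map-filter P? f f≡0 []      = refl
sumℚ-map-filter P? f f≡0 (i ∷ l) with P? i
... | yes _  = cong (_+_ (f i)) (sumℚ-map-filter P? f f≡0 l)
... | no ¬Pi = begin
  sumℚ (map f (filter P? l)) ≡⟨ sumℚ-map-filter P? f f≡0 l ⟩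
  sumℚ (map f l)             ≡⟨ +-identityˡ _ ⟨
  0ℚ + sumℚ (map f l)        ≡⟨ cong (_+ sumℚ (map f l)) (f≡0 i ¬Pi) ⟨
  f i + sumℚ (map f l)       ∎

sumℚ-applyUpTo : ∀ (f : ℕ → ℚ) n → sumℚ (applyUpTo f n) ≡ sum {n} (f ∘ toℕ)
sumℚ-applyUpTo f zero    = refl
sumℚ-applyUpTo f (suc n) = cong (_+_ (f 0)) (sumℚ-applyUpTo (f ∘ suc) n)

∑≤j<-full : ∀ k n (f : ℕ → ℚ) → (∀ j → j < k → f j ≡ 0ℚ) →
            ∑[ k ≤j< n ] f ≡ sum {n} (f ∘ toℕ)
∑≤j<-full k n f f≡0 = begin
  ∑[ k ≤j< n ] f        ≡⟨ sumℚ-map-filter (k ≤?_) f (λ j k≰j → f≡0 j (≰⇒> k≰j)) (upTo n) ⟩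
  sumℚ (map f (upTo n)) ≡⟨ cong sumℚ (map-upTo f n) ⟩
  sumℚ (applyUpTo f n)  ≡⟨ sumℚ-applyUpTo f n ⟩
  sum {n} (f ∘ toℕ)     ∎

-- The arguments p/i

-- A reversal without truncated subtraction.
applyDownFrom≡applyUpTo : ∀ {A : Set} (h : ℚ → A) n →
  applyDownFrom (λ i → h (ι (suc i))) n ≡ applyUpTo (λ i → h (ι n - ι i)) n
applyDownFrom≡applyUpTo h zero    = refl
applyDownFrom≡applyUpTo h (suc n) = cong₂ _∷_
  -- The head has index 0, where subtracting `ι 0` amounts to adding `0ℚ`.
  (cong h (sym (+-identityʳ (ι (suc n)))))
  (begin
    applyDownFrom (λ i → h (ι (suc i))) n      ≡⟨ applyDownFrom≡applyUpTo h n ⟩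
    applyUpTo (λ i → h (ι n - ι i)) n          ≡⟨ map-upTo _ n ⟨
    map (λ i → h (ι n - ι i)) (upTo n)         ≡⟨ map-cong (λ i → cong h (shift i)) (upTo n) ⟩
    map (λ i → h (ι (suc n) - ι (suc i))) (upTo n)
                                               ≡⟨ map-upTo _ n ⟩
    applyUpTo (λ i → h (ι (suc n) - ι (suc i))) n ∎)
  where
  shift : ∀ i → ι n - ι i ≡ ι (suc n) - ι (suc i)
  shift i = ≡-trans
    (solve 2 (λ a b → a :- b := (con 1ℚ :+ a) :- (con 1ℚ :+ b)) refl (ι n) (ι i))
    (sym (cong₂ _-_ (ι-+ 1 n) (ι-+ 1 i)))

foldr-const-* : ∀ {A : Set} c (l : List A) → foldr (λ _ → c *_) 1ℚ l ≡ c ^ length l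
foldr-const-* c []      = refl
foldr-const-* c (_ ∷ l) = cong (c *_) (foldr-const-* c l)

-- Here p is `suc n`, and the index `i` stands for the denominator `suc i`. Hence `ι n - ι i` is p
-- minus that denominator, and `c i` is the scalar -1/`suc i`.
coeff-reflect : ∀ n k → let xs = applyUpTo (λ i → + suc n / suc i) n in
  coeff (map (λ x → 1ℚ - x , - x) xs) k ≡ (- 1ℚ) ^ n * coeff (1+ xs t) k
coeff-reflect n k = begin
  coeff (map (λ x → 1ℚ - x , - x) (applyUpTo X n)) k
    ≡⟨ cong (λ l → coeff l k) (map-applyUpTo-upTo (λ x → 1ℚ - x , - x)) ⟩
  coeff (map (λ i → 1ℚ - X i , - X i) (upTo n)) k
    ≡⟨ cong (λ l → coeff l k) (map-cong (λ i → cong₂ _,_ (factor i) (factor′ i)) (upTo n)) ⟩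
  coeff (map (λ i → c i · (ι n - ι i , ι (suc n))) (upTo n)) k
    ≡⟨ coeff-· c (λ i → ι n - ι i , ι (suc n)) (upTo n) k ⟩
  d * coeff (map (λ i → ι n - ι i , ι (suc n)) (upTo n)) k
    -- Only the linear factors are reversed; the scalars collected in `d` stay and are then paired
    -- with the factors in their new order.
    ≡⟨ cong (d *_) reversal ⟩
  d * coeff (map (λ i → ι (suc i) , ι (suc n)) (upTo n)) k
    ≡⟨ coeff-· c (λ i → ι (suc i) , ι (suc n)) (upTo n) k ⟨
  coeff (map (λ i → c i · (ι (suc i) , ι (suc n))) (upTo n)) k
    ≡⟨ cong (λ l → coeff l k) (map-cong (λ i → cong₂ _,_ (unit i) (unit′ i)) (upTo n)) ⟩
  coeff (map (λ i → - 1ℚ · (1ℚ , X i)) (upTo n)) k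
    ≡⟨ coeff-· (const (- 1ℚ)) (λ i → 1ℚ , X i) (upTo n) k ⟩
  foldr (λ _ → - 1ℚ *_) 1ℚ (upTo n) * coeff (map (λ i → 1ℚ , X i) (upTo n)) k
    ≡⟨ cong₂ _*_
         (≡-trans (foldr-const-* (- 1ℚ) (upTo n)) (cong ((- 1ℚ) ^_) (length-upTo n)))
         (cong (λ l → coeff l k) (sym (map-applyUpTo-upTo (1ℚ ,_)))) ⟩
  (- 1ℚ) ^ n * coeff (1+ applyUpTo X n t) k ∎
  where
  X r c : ℕ → ℚ
  X i = + suc n / suc i
  r i = + 1 / suc i
  c i = - r i
  d = foldr (λ i → c i *_) 1ℚ (upTo n)

  map-applyUpTo-upTo : ∀ {A : Set} (h : ℚ → A) → map h (applyUpTo X n) ≡ map (h ∘ X) (upTo n)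
  map-applyUpTo-upTo h = ≡-trans (map-applyUpTo X h n) (sym (map-upTo (h ∘ X) n))

  reversal : coeff (map (λ i → ι n - ι i , ι (suc n)) (upTo n)) k
           ≡ coeff (map (λ i → ι (suc i) , ι (suc n)) (upTo n)) k
  reversal = begin
    coeff (map (λ i → ι n - ι i , ι (suc n)) (upTo n)) k
      ≡⟨ cong (λ l → coeff l k) (map-upTo _ n) ⟩
    coeff (applyUpTo (λ i → ι n - ι i , ι (suc n)) n) k
      ≡⟨ cong (λ l → coeff l k) (applyDownFrom≡applyUpTo (_, ι (suc n)) n) ⟨
    coeff (applyDownFrom (λ i → ι (suc i) , ι (suc n)) n) k
      ≡⟨ cong (λ l → coeff l k) (reverse-applyUpTo _ n) ⟨
    _
      ≡⟨ coeff-↭ (↭-reverse (applyUpTo (λ i → ι (suc i) , ι (suc n)) n)) k ⟩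
    coeff (applyUpTo (λ i → ι (suc i) , ι (suc n)) n) k
      ≡⟨ cong (λ l → coeff l k) (map-upTo _ n) ⟨
    coeff (map (λ i → ι (suc i) , ι (suc n)) (upTo n)) k ∎

  unit : ∀ i → c i * ι (suc i) ≡ - 1ℚ * 1ℚ
  unit i = ≡-trans
    (solve 2 (λ r a → (:- r) :* a := (:- con 1ℚ) :* (a :* r)) refl (r i) (ι (suc i)))
    (cong (- 1ℚ *_) (*-inverse-/ i))

  unit′ : ∀ i → c i * ι (suc n) ≡ - 1ℚ * X i
  unit′ i = ≡-trans
    (solve 2 (λ r a → (:- r) :* a := (:- con 1ℚ) :* (a :* r)) refl (r i) (ι (suc n)))
    (cong (- 1ℚ *_) (sym (/-as-* (suc n) i)))

  factor′ : ∀ i → - X i ≡ c i * ι (suc n)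
  factor′ i = ≡-trans (solve 1 (λ x → :- x := (:- con 1ℚ) :* x) refl (X i)) (sym (unit′ i))

  factor : ∀ i → 1ℚ - X i ≡ c i * (ι n - ι i)
  factor i = begin
    1ℚ - X i
      -- Over the common denominator `suc i`, the summands 1 in `suc i` and `suc n` cancel.
      ≡⟨ cong₂ _-_ (sym (*-inverse-/ i)) (/-as-* (suc n) i) ⟩
    ι (suc i) * r i - ι (suc n) * r i
      ≡⟨ cong₂ (λ a b → a * r i - b * r i) (ι-+ 1 i) (ι-+ 1 n) ⟩
    (1ℚ + ι i) * r i - (1ℚ + ι n) * r i
      ≡⟨ solve 3 (λ a b r → (con 1ℚ :+ a) :* r :- (con 1ℚ :+ b) :* r
                         := (:- r) :* (b :- a)) refl (ι i) (ι n) (r i) ⟩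
    c i * (ι n - ι i) ∎

-- The sign (-1)^(p-1)

-- Parity of `n`, by induction in steps of two. The odd case is stated as a divisibility so that
-- primality applies to it.
-1^n≡1⊎2∣1+n : ∀ n → (- 1ℚ) ^ n ≡ 1ℚ ⊎ 2 ∣ suc n
-1^n≡1⊎2∣1+n zero          = inj₁ refl
-1^n≡1⊎2∣1+n (suc zero)    = inj₂ ∣-refl
-1^n≡1⊎2∣1+n (suc (suc n)) with -1^n≡1⊎2∣1+n n
... | inj₁ eq    = inj₁ (cong (λ y → - 1ℚ * (- 1ℚ * y)) eq)
... | inj₂ 2∣1+n = inj₂ (∣m∣n⇒∣m+n ∣-refl 2∣1+n)

-1^[p-1]≡1 : ∀ n → Prime (suc n) → suc n ≥ 3 → (- 1ℚ) ^ n ≡ 1ℚ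
-1^[p-1]≡1 n pr p≥3 with -1^n≡1⊎2∣1+n n
... | inj₁ eq    = eq
-- A divisor 2 of the prime would be 1 or the prime itself, and the latter contradicts the bound 3.
... | inj₂ 2∣1+n with prime⇒irreducible pr 2∣1+n
...   | inj₁ ()
-1^[p-1]≡1 _ _ (s≤s (s≤s ())) | inj₂ _ | inj₂ refl

-- Comparison of the coefficients of t^k

proposition3p1 : (k p : ℕ) → Prime p → p ≥ 3 →
    e k (p/[1⋯p-1] p)
    + ∑[ k ≤j< p ] (λ j → (- 1ℚ) ^ suc j * (+ (j C k) / 1) * e j (p/[1⋯p-1] p))
    ≡ 0ℚ
proposition3p1 k (suc n) pr p≥3 = begin
  e k x + ∑[ k ≤j< suc n ] (λ j → ±C k j * e j x)
    -- The sum may start at 0, because `j C k` is 0 for j < k.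
    ≡⟨ cong (_+_ (e k x)) (∑≤j<-full k (suc n) (λ j → ±C k j * e j x) below-k) ⟩
  e k x + sum {suc n} (λ i → ±C k (toℕ i) * e (toℕ i) x)
    ≡⟨ cong₂ _+_ (e-coeff X n k)
         (sum-cong-≗ {suc n} (λ i → cong (±C k (toℕ i) *_) (e-coeff X n (toℕ i)))) ⟩
  coeff (1+ xs t) k + sum {suc n} (λ i → ±C k (toℕ i) * coeff (1+ xs t) (toℕ i))
    ≡⟨ cong (λ m → coeff (1+ xs t) k
                   + sum {suc m} (λ i → ±C k (toℕ i) * coeff (1+ xs t) (toℕ i)))
         -- The bound `n` becomes `length xs`, the form in which `weighted` sums.
         (length-applyUpTo X n) ⟨
  coeff (1+ xs t) k + weighted (±C k) xs
    ≡⟨ cong (_+_ (coeff (1+ xs t) k)) (weighted-±C xs k) ⟩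
  coeff (1+ xs t) k - coeff (map (λ x → 1ℚ - x , - x) xs) k
    ≡⟨ cong (λ u → coeff (1+ xs t) k - u) (coeff-reflect n k) ⟩
  coeff (1+ xs t) k - (- 1ℚ) ^ n * coeff (1+ xs t) k
    -- Since p is an odd prime, the sign is 1 and the two coefficients cancel.
    ≡⟨ cong (λ s → coeff (1+ xs t) k - s * coeff (1+ xs t) k) (-1^[p-1]≡1 n pr p≥3) ⟩
  coeff (1+ xs t) k - 1ℚ * coeff (1+ xs t) k
    ≡⟨ cong (λ u → coeff (1+ xs t) k - u) (*-identityˡ (coeff (1+ xs t) k)) ⟩
  coeff (1+ xs t) k - coeff (1+ xs t) k
    ≡⟨ +-inverseʳ (coeff (1+ xs t) k) ⟩
  0ℚ ∎
  where
  X : ℕ → ℚ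
  X i = + suc n / suc i
  xs = applyUpTo X n
  x = p/[1⋯p-1] (suc n)
  below-k : ∀ j → j < k → ±C k j * e j x ≡ 0ℚ
  below-k j j<k = begin
    (- 1ℚ) ^ suc j * ι (j C k) * e j x
      ≡⟨ cong (λ m → (- 1ℚ) ^ suc j * ι m * e j x) (k>n⇒nCk≡0 j<k) ⟩
    (- 1ℚ) ^ suc j * 0ℚ * e j x
      ≡⟨ cong (_* e j x) (*-zeroʳ ((- 1ℚ) ^ suc j)) ⟩
    0ℚ * e j x
      ≡⟨ *-zeroˡ (e j x) ⟩
    0ℚ ∎
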